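{- Let $\phi_1$ and $\phi_2$ be propositional formulas over a set of atoms $\mathcal{P}$. The formula $\phi_1 \leftrightarrow \phi_2$ is valid in the logic of here-and-there (i.e. satisfied by every HT-interpretation $\langle H,T\rangle$ over $\mathcal{P}$) if and only if the formula $\sigma^*(\phi_1) \leftrightarrow \sigma^*(\phi_2)$ is satisfied by every classical interpretation $I$ over the alphabet $\mathcal{P} \cup \mathcal{P}'$ such that $I \models \mathcal{A}$.
   Context: Formulas are propositional formulas built from a set $\mathcal{P}$ of atoms and the symbols $\bot, \top, \neg, \land, \lor, \rightarrow$ ($\neg$ is a primitive connective); $F \leftrightarrow G$ abbreviates $(F \rightarrow G) \land (G \rightarrow F)$. An HT-interpretation is an ordered pair $\langle H,T\rangle$ of sets of atoms with $H \subseteq T \subseteq \mathcal{P}$. Satisfaction in the logic of here-and-there is defined recursively: $\langle H,T\rangle \not\models \bot$; $\langle H,T\rangle \models \top$; for $p \in \mathcal{P}$, $\langle H,T\rangle \models p$ iff $p \in H$; $\langle H,T\rangle \models \phi_1 \land \phi_2$ iff $\langle H,T\rangle \models \phi_1$ and $\langle H,T\rangle \models \phi_2$; $\langle H,T\rangle \models \phi_1 \lor \phi_2$ iff $\langle H,T\rangle \models \phi_1$ or $\langle H,T\rangle \models \phi_2$; $\langle H,T\rangle \models \neg\phi$ iff $\langle T,T\rangle \not\models \phi$; $\langle H,T\rangle \models \phi_1 \rightarrow \phi_2$ iff ($\langle H,T\rangle \models \phi_1$ implies $\langle H,T\rangle \models \phi_2$) and ($\langle T,T\rangle \models \phi_1$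 implies $\langle T,T\rangle \models \phi_2$). Let $\mathcal{P}' = \{p' \mid p \in \mathcal{P}\}$ be a set of new atoms, disjoint from $\mathcal{P}$ (with $p \mapsto p'$ injective). For a formula $\phi$ over $\mathcal{P}$, $\phi'$ is the result of replacing every atom $p$ in $\phi$ by $p'$. A classical interpretation over $\mathcal{P} \cup \mathcal{P}'$ is a subset $I \subseteq \mathcal{P} \cup \mathcal{P}'$ (the set of true atoms). Let $\mathcal{A} = \{p \rightarrow p' \mid p \in \mathcal{P}\}$. The transformation $\sigma^*$, from formulas over $\mathcal{P}$ to formulas over $\mathcal{P} \cup \mathcal{P}'$, is defined recursively by: $\sigma^*(\phi) = \phi$ if $\phi \in \mathcal{P} \cup \{\top,\bot\}$; $\sigma^*(\phi_1 \circ \phi_2) = \sigma^*(\phi_1) \circ \sigma^*(\phi_2)$ for $\circ \in \{\land,\lor\}$; $\sigma^*(\neg\psi) = \neg\psi'$; $\sigma^*(\phi_1 \rightarrow \phi_2) = (\sigma^*(\phi_1) \rightarrow \sigma^*(\phi_2)) \land (\phi_1' \rightarrow \phi_2')$. -}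

module Defs where

open import Data.Bool using (Bool; true)
open import Data.Empty using (⊥)
open import Data.Product using (∃-syntax; _×_)
open import Data.Sum using (_⊎_; inj₁; inj₂)
open import Data.Unit using (⊤)
open import Level using (Level)
open import Relation.Binary.PropositionalEquality using (_≡_)
open import Relation.Nullary using (¬_)
open import Relation.Unary using (Pred)

private
  variable
    a b : Level
    A : Set a
    B : Set b

infix  30 ¬ᶠ_
infixr 25 _∧ᶠ_
infixr 24 _∨ᶠ_
infixr 23 _→ᶠ_
infix  22 _↔ᶠ_

data Formula (A : Set a) : Set a where
  atom : A → Formula A
  ⊥ᶠ ⊤ᶠ : Formula A
  ¬ᶠ_ : Formula A → Formula A
  _∧ᶠ_ _∨ᶠ_ _→ᶠ_ : Formula A → Formula A → Formula A

_↔ᶠ_ : Formula A → Formula A → Formula A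
φ ↔ᶠ ψ = (φ →ᶠ ψ) ∧ᶠ (ψ →ᶠ φ)

mapAtoms : (A → B) → Formula A → Formula B
mapAtoms f (atom p) = atom (f p)
mapAtoms f ⊥ᶠ       = ⊥ᶠ
mapAtoms f ⊤ᶠ       = ⊤ᶠ
mapAtoms f (¬ᶠ φ)   = ¬ᶠ mapAtoms f φ
mapAtoms f (φ ∧ᶠ ψ) = mapAtoms f φ ∧ᶠ mapAtoms f ψ
mapAtoms f (φ ∨ᶠ ψ) = mapAtoms f φ ∨ᶠ mapAtoms f ψ
mapAtoms f (φ →ᶠ ψ) = mapAtoms f φ →ᶠ mapAtoms f ψ

-- Sets of atoms are two-valued characteristic functions.  Membership, and
-- hence satisfaction of a formula, is therefore decidable, so that
-- the type-theoretic connectives in the semantic clauses behave classically.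
-- With Set-valued predicates instead, laws such as p ∨ ¬ p would not be
-- provably valid over the classical interpretations.
Subset : Set a → Set a
Subset A = A → Bool

infix 4 _∈_ _⊆_

_∈_ : A → Subset A → Set
p ∈ S = S p ≡ true

_⊆_ : {A : Set a} → Subset A → Subset A → Set a
S ⊆ S′ = ∀ p → p ∈ S → p ∈ S′

record HTInterpretation (A : Set a) : Set a where
  constructor ⟨_,_,_⟩
  field
    here       : Subset A
    there      : Subset A
    here⊆there : here ⊆ there

open HTInterpretation public

-- ⟨ H , T ⟩ ↦ ⟨ T , T ⟩
total : HTInterpretation A → HTInterpretation A
total M = ⟨ there M , there M , (λ _ p∈T → p∈T) ⟩

infix 4 _⊨HT_ _⊨_ _⊨ᵀ_

_⊨HT_ : HTInterpretation A → Formula A → Set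
M ⊨HT atom p   = p ∈ here M
M ⊨HT ⊥ᶠ       = ⊥
M ⊨HT ⊤ᶠ       = ⊤
M ⊨HT ¬ᶠ φ     = ¬ (total M ⊨HT φ)
M ⊨HT (φ ∧ᶠ ψ) = (M ⊨HT φ) × (M ⊨HT ψ)
M ⊨HT (φ ∨ᶠ ψ) = (M ⊨HT φ) ⊎ (M ⊨HT ψ)
M ⊨HT (φ →ᶠ ψ) = (M ⊨HT φ → M ⊨HT ψ) × (total M ⊨HT φ → total M ⊨HT ψ)

HTValid : {A : Set a} → Formula A → Set a
HTValid {A = A} φ = (M : HTInterpretation A) → M ⊨HT φ

_⊨_ : Subset A → Formula A → Set
I ⊨ atom p   = p ∈ I
I ⊨ ⊥ᶠ       = ⊥
I ⊨ ⊤ᶠ       = ⊤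
I ⊨ ¬ᶠ φ     = ¬ (I ⊨ φ)
I ⊨ (φ ∧ᶠ ψ) = (I ⊨ φ) × (I ⊨ ψ)
I ⊨ (φ ∨ᶠ ψ) = (I ⊨ φ) ⊎ (I ⊨ ψ)
I ⊨ (φ →ᶠ ψ) = I ⊨ φ → I ⊨ ψ

_⊨ᵀ_ : {A : Set a} → Subset A → Pred (Formula A) a → Set a
I ⊨ᵀ Γ = ∀ φ → Γ φ → I ⊨ φ

-- The alphabet 𝒫 ∪ 𝒫′: inj₁ p is the atom p and inj₂ p is its copy p′.
Doubled : Set a → Set a
Doubled P = P ⊎ P

infix 35 _′

_′ : {P : Set a} → Formula P → Formula (Doubled P)
φ ′ = mapAtoms inj₂ φ

-- { p → p′ ∣ p ∈ 𝒫 }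
𝒜 : {P : Set a} → Pred (Formula (Doubled P)) a
𝒜 φ = ∃[ p ] φ ≡ (atom (inj₁ p) →ᶠ atom (inj₂ p))

σ* : {P : Set a} → Formula P → Formula (Doubled P)
σ* (atom p) = atom (inj₁ p)
σ* ⊥ᶠ       = ⊥ᶠ
σ* ⊤ᶠ       = ⊤ᶠ
σ* (¬ᶠ φ)   = ¬ᶠ φ ′
σ* (φ ∧ᶠ ψ) = σ* φ ∧ᶠ σ* ψ
σ* (φ ∨ᶠ ψ) = σ* φ ∨ᶠ σ* ψ
σ* (φ →ᶠ ψ) = (σ* φ →ᶠ σ* ψ) ∧ᶠ (φ ′ →ᶠ ψ ′)

{-# OPTIONS --safe #-}

-- A pair ⟨ H , T ⟩ with H ⊆ T is the same thing as a classical model I of 𝒜: I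
-- interprets p by H and p′ by T.  Under this correspondence φ ′ says that φ
-- holds in ⟨ T , T ⟩, and σ* φ says that φ holds in ⟨ H , T ⟩.
module Submission where

open import Data.Product using (_,_; proj₁; proj₂)
open import Data.Product.Function.NonDependent.Propositional using (_×-⇔_)
open import Data.Sum using (inj₁; inj₂; [_,_])
open import Data.Sum.Function.Propositional using (_⊎-⇔_)
open import Defs
open import Function using (_∘_)
open import Function.Bundles using (_⇔_; mk⇔; module Equivalence)
open import Function.Properties.Equivalence using () renaming (refl to ⇔-refl)
open import Function.Related.TypeIsomorphisms using (→-cong-⇔; ¬-cong-⇔)
open import Relation.Binary.PropositionalEquality using (refl)

open Equivalence using (to; from)

module _ {a} {P : Set a} where

  toHT : (I : Subset (Doubled P)) → I ∘ inj₁ ⊆ I ∘ inj₂ → HTInterpretation P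
  toHT I H⊆T = ⟨ I ∘ inj₁ , I ∘ inj₂ , H⊆T ⟩

  toClassical : HTInterpretation P → Subset (Doubled P)
  toClassical M = [ here M , there M ]

  ⊨ᵀ𝒜⇔⊆ : (I : Subset (Doubled P)) → I ⊨ᵀ 𝒜 ⇔ I ∘ inj₁ ⊆ I ∘ inj₂
  ⊨ᵀ𝒜⇔⊆ I = mk⇔ (λ I⊨𝒜 p → I⊨𝒜 _ (p , refl)) λ { H⊆T _ (p , refl) → H⊆T p }

  toClassical-⊨ᵀ𝒜 : (M : HTInterpretation P) → toClassical M ⊨ᵀ 𝒜
  toClassical-⊨ᵀ𝒜 M = from (⊨ᵀ𝒜⇔⊆ (toClassical M)) (here⊆there M)

  -- At a total interpretation, HT satisfaction collapses to classical satisfaction in the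
  -- there-world, which `I` stores on the primed atoms.
  total-⊨HT⇔⊨′ : ∀ I H⊆T φ → total (toHT I H⊆T) ⊨HT φ ⇔ I ⊨ φ ′
  total-⊨HT⇔⊨′ I s (atom p) = ⇔-refl
  total-⊨HT⇔⊨′ I s ⊥ᶠ       = ⇔-refl
  total-⊨HT⇔⊨′ I s ⊤ᶠ       = ⇔-refl
  total-⊨HT⇔⊨′ I s (¬ᶠ φ)   = ¬-cong-⇔ (total-⊨HT⇔⊨′ I s φ)
  total-⊨HT⇔⊨′ I s (φ ∧ᶠ ψ) = total-⊨HT⇔⊨′ I s φ ×-⇔ total-⊨HT⇔⊨′ I s ψ
  total-⊨HT⇔⊨′ I s (φ ∨ᶠ ψ) = total-⊨HT⇔⊨′ I s φ ⊎-⇔ total-⊨HT⇔⊨′ I s ψ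
  -- `total` is idempotent by computation, so both conjuncts of the HT clause are the same
  -- implication: one is projected out, and `f` yields both.
  total-⊨HT⇔⊨′ I s (φ →ᶠ ψ) = mk⇔ (to φ→ψ ∘ proj₁) λ f → from φ→ψ f , from φ→ψ f
    where φ→ψ = →-cong-⇔ (total-⊨HT⇔⊨′ I s φ) (total-⊨HT⇔⊨′ I s ψ)

  -- `σ*` copies the HT clauses; wherever these pass to `total`, it has a primed formula, handled by
  -- `total-⊨HT⇔⊨′`.
  ⊨HT⇔⊨σ* : ∀ I H⊆T φ → toHT I H⊆T ⊨HT φ ⇔ I ⊨ σ* φ
  ⊨HT⇔⊨σ* I s (atom p) = ⇔-refl
  ⊨HT⇔⊨σ* I s ⊥ᶠ       = ⇔-refl
  ⊨HT⇔⊨σ* I s ⊤ᶠ       = ⇔-refl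
  ⊨HT⇔⊨σ* I s (¬ᶠ φ)   = ¬-cong-⇔ (total-⊨HT⇔⊨′ I s φ)
  ⊨HT⇔⊨σ* I s (φ ∧ᶠ ψ) = ⊨HT⇔⊨σ* I s φ ×-⇔ ⊨HT⇔⊨σ* I s ψ
  ⊨HT⇔⊨σ* I s (φ ∨ᶠ ψ) = ⊨HT⇔⊨σ* I s φ ⊎-⇔ ⊨HT⇔⊨σ* I s ψ
  ⊨HT⇔⊨σ* I s (φ →ᶠ ψ) =
    →-cong-⇔ (⊨HT⇔⊨σ* I s φ) (⊨HT⇔⊨σ* I s ψ) ×-⇔
    →-cong-⇔ (total-⊨HT⇔⊨′ I s φ) (total-⊨HT⇔⊨′ I s ψ)

  HTValid-→⇔⊨σ* : (φ ψ : Formula P) →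
    HTValid (φ →ᶠ ψ) ⇔ (∀ I → I ⊨ᵀ 𝒜 → I ⊨ (σ* φ →ᶠ σ* ψ))
  HTValid-→⇔⊨σ* φ ψ = mk⇔
    (λ valid I I⊨𝒜 → let s = to (⊨ᵀ𝒜⇔⊆ I) I⊨𝒜 in
      to (σ*-→ I s) (proj₁ (valid (toHT I s))))
    -- The there-conjunct at `M` is the here-conjunct at `total M`, which validity also covers.
    (λ valid M → here-→ valid M , here-→ valid (total M))
    where
    σ*-→ : ∀ I s → (toHT I s ⊨HT φ → toHT I s ⊨HT ψ) ⇔ (I ⊨ (σ* φ →ᶠ σ* ψ))
    σ*-→ I s = →-cong-⇔ (⊨HT⇔⊨σ* I s φ) (⊨HT⇔⊨σ* I s ψ)

    here-→ : (∀ I → I ⊨ᵀ 𝒜 → I ⊨ (σ* φ →ᶠ σ* ψ)) → ∀ M → M ⊨HT φ → M ⊨HT ψ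
    here-→ valid M = from (σ*-→ (toClassical M) (here⊆there M))
      (valid (toClassical M) (toClassical-⊨ᵀ𝒜 M))

theorem2 : ∀ {a} {P : Set a} (φ₁ φ₂ : Formula P) →
    HTValid (φ₁ ↔ᶠ φ₂) ⇔
    (∀ (I : Subset (Doubled P)) → I ⊨ᵀ 𝒜 → I ⊨ (σ* φ₁ ↔ᶠ σ* φ₂))
-- Universal quantification distributes over the two conjuncts of `↔ᶠ`, so each implication is
-- treated separately.
theorem2 φ₁ φ₂ = mk⇔
  (λ valid I I⊨𝒜 →
    to (HTValid-→⇔⊨σ* φ₁ φ₂) (proj₁ ∘ valid) I I⊨𝒜 ,
    to (HTValid-→⇔⊨σ* φ₂ φ₁) (proj₂ ∘ valid) I I⊨𝒜)
  (λ valid M →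
    from (HTValid-→⇔⊨σ* φ₁ φ₂) (λ I I⊨𝒜 → proj₁ (valid I I⊨𝒜)) M ,
    from (HTValid-→⇔⊨σ* φ₂ φ₁) (λ I I⊨𝒜 → proj₂ (valid I I⊨𝒜)) M)
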